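{- Let $\mathbf A=(A;\cdot,\to,\leadsto,1)$ be a pseudo-hoop and let $M\subseteq A$. Let $G=M^\perp\cdot M^{\perp\perp}=\{a\cdot b\mid a\in M^\perp,\ b\in M^{\perp\perp}\}$. If there is an element $x\in A$ with $x\notin G$ such that the set $\{a\in G\mid x\le a\}$ has a least element, then $\mathbf A$ is subdirectly reducible.
   Context: A pseudo-hoop is an algebra $(A;\cdot,\to,\leadsto,1)$ of type $\langle 2,2,2,0\rangle$ such that for all $x,y,z\in A$: $x\cdot 1=x=1\cdot x$; $x\to x=1=x\leadsto x$; $(x\cdot y)\to z=x\to(y\to z)$; $(x\cdot y)\leadsto z=y\leadsto(x\leadsto z)$; and $(x\to y)\cdot x=(y\to x)\cdot y=x\cdot(x\leadsto y)=y\cdot(y\leadsto x)$. Setting $x\le y$ iff $x\to y=1$ gives a partial order with greatest element $1$. For $x,y\in A$, "$x\vee y=1$" means that the supremum of $\{x,y\}$ exists and equals $1$. For $M\subseteq A$, $M^\perp=\{x\in A\mid x\vee y=1\text{ for every }y\in M\}$ and $M^{\perp\perp}=(M^\perp)^\perp$. An algebra is subdirectly reducible if it is not subdirectly irreducible, i.e. its identity congruence is the intersection of a family of congruences each different from the identity congruence (equivalently, it is a subdirect product of algebras none of whose projections is an isomorphism). -}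

module Defs where

open import Level using (Level; suc)
open import Data.Product using (Σ-syntax; ∃-syntax; _×_)
open import Relation.Binary.Core using (Rel; _⇔_; _Preserves₂_⟶_⟶_)
open import Relation.Binary.Structures using (IsEquivalence)
open import Relation.Binary.PropositionalEquality using (_≡_)
open import Relation.Nullary using (¬_)
open import Relation.Unary using (Pred; _∈_)


record PseudoHoop (a : Level) : Set (suc a) where
  infixl 7 _∙_
  infixr 6 _⇾_ _⇝_
  infix  4 _≤_
  field
    Carrier   : Set a
    _∙_       : Carrier → Carrier → Carrier
    _⇾_       : Carrier → Carrier → Carrier
    _⇝_       : Carrier → Carrier → Carrier
    𝟙         : Carrier
    identityʳ : ∀ x → x ∙ 𝟙 ≡ x
    identityˡ : ∀ x → 𝟙 ∙ x ≡ x
    ⇾-refl    : ∀ x → x ⇾ x ≡ 𝟙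
    ⇝-refl    : ∀ x → x ⇝ x ≡ 𝟙
    ⇾-curry   : ∀ x y z → (x ∙ y) ⇾ z ≡ x ⇾ (y ⇾ z)
    ⇝-curry   : ∀ x y z → (x ∙ y) ⇝ z ≡ y ⇝ (x ⇝ z)
    ⇾-comm    : ∀ x y → (x ⇾ y) ∙ x ≡ (y ⇾ x) ∙ y
    ⇾-⇝       : ∀ x y → (y ⇾ x) ∙ y ≡ x ∙ (x ⇝ y)
    ⇝-comm    : ∀ x y → x ∙ (x ⇝ y) ≡ y ∙ (y ⇝ x)

  _≤_ : Rel Carrier a
  x ≤ y = x ⇾ y ≡ 𝟙

  IsSupremum : Carrier → Carrier → Carrier → Set a
  IsSupremum x y s = x ≤ s × y ≤ s × (∀ z → x ≤ z → y ≤ z → s ≤ z)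

  IsLeast : Pred Carrier a → Pred Carrier a
  IsLeast S m = m ∈ S × (∀ {y} → y ∈ S → m ≤ y)

  infix 8 _^⊥
  _^⊥ : Pred Carrier a → Pred Carrier a
  (M ^⊥) x = ∀ {y} → y ∈ M → IsSupremum x y 𝟙

  infixl 7 _⊙_
  _⊙_ : Pred Carrier a → Pred Carrier a → Pred Carrier a
  (S ⊙ T) x = ∃[ s ] ∃[ t ] (s ∈ S × t ∈ T × x ≡ s ∙ t)

module _ {a : Level} (𝐀 : PseudoHoop a) where
  open PseudoHoop 𝐀

  record Congruence : Set (suc a) where
    infix 4 _∼_
    field
      _∼_           : Rel Carrier a
      isEquivalence : IsEquivalence _∼_
      ∙-cong        : _∙_ Preserves₂ _∼_ ⟶ _∼_ ⟶ _∼_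
      ⇾-cong        : _⇾_ Preserves₂ _∼_ ⟶ _∼_ ⟶ _∼_
      ⇝-cong        : _⇝_ Preserves₂ _∼_ ⟶ _∼_ ⟶ _∼_

  -- The positive form of the negation of subdirect irreducibility: a family of
  -- congruences other than _≡_ that intersect in _≡_.
  SubdirectlyReducible : Set (suc a)
  SubdirectlyReducible =
    Σ[ I ∈ Set a ] Σ[ θ ∈ (I → Congruence) ]
      (∀ i → ¬ (Congruence._∼_ (θ i) ⇔ _≡_)) ×
      ((λ x y → ∀ i → Congruence._∼_ (θ i) x y) ⇔ _≡_)

{-# OPTIONS --safe #-}
-- Put P = M^⊥, Q = M^⊥⊥ and h = g ⇾ x, where g is the least element of the
-- filter G = P ⊙ Q above x.  The filters P ∩ ↑h and Q ∩ ↑h meet in 𝟙, and if one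
-- of them were trivial, then h would lie in Q or in P, so x = h ∙ g would lie
-- in G.  They are normal because leastness of g makes every z ∈ G above h
-- satisfy z ∙ g = g = g ∙ z and z ∙ h = h = h ∙ z: whenever such a z fixes an
-- element s, the conjugates of z lie above s.  Taking s = h keeps conjugates
-- in ↑h, and taking for s the components of g in P and Q keeps them in P and Q.
module Submission where

open import Data.Bool.Base using (Bool; true; false)
open import Data.Product using (∃-syntax; _×_; _,_; proj₁; proj₂; swap)
open import Level using (Level; Lift; lift)
open import Relation.Binary.Bundles using (Poset)
open import Relation.Binary.PropositionalEquality
open import Relation.Nullary using (¬_)
open import Relation.Unary using (Pred; _∈_; _∉_; _⊆_)
import Relation.Binary.Reasoning.PartialOrder as ≤-Reasoning
open import Defs

module PseudoHoopProperties {a : Level} (𝐀 : PseudoHoop a) where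
  open PseudoHoop 𝐀

  -- The partial order and its greatest element.

  ≤-refl : ∀ {x} → x ≤ x
  ≤-refl = ⇾-refl _

  ≤-antisym : ∀ {x y} → x ≤ y → y ≤ x → x ≡ y
  ≤-antisym {x} {y} x≤y y≤x = begin
    x            ≡⟨ identityˡ x ⟨
    𝟙 ∙ x        ≡⟨ cong (_∙ x) x≤y ⟨
    (x ⇾ y) ∙ x  ≡⟨ ⇾-comm x y ⟩
    (y ⇾ x) ∙ y  ≡⟨ cong (_∙ y) y≤x ⟩
    𝟙 ∙ y        ≡⟨ identityˡ y ⟩
    y            ∎
    where open ≡-Reasoning

  𝟙⇾-as-∙ : ∀ x → 𝟙 ⇾ x ≡ (x ⇾ 𝟙) ∙ x
  𝟙⇾-as-∙ x = trans (sym (identityʳ _)) (⇾-comm 𝟙 x)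

  x≤𝟙⇾x : ∀ x → x ≤ 𝟙 ⇾ x
  x≤𝟙⇾x x = begin
    x ⇾ 𝟙 ⇾ x  ≡⟨ ⇾-curry x 𝟙 x ⟨
    x ∙ 𝟙 ⇾ x  ≡⟨ cong (_⇾ x) (identityʳ x) ⟩
    x ⇾ x      ≡⟨ ⇾-refl x ⟩
    𝟙          ∎
    where open ≡-Reasoning

  -- The instance of `x≤𝟙` that the general case rests on. Replacing the inner `𝟙` by `x ⇾ 𝟙 ⇾ x`
  -- and uncurrying leaves `𝟙 ⇾ x` on both sides.
  ⇾𝟙⇾𝟙 : ∀ x → (x ⇾ 𝟙) ⇾ 𝟙 ≡ 𝟙
  ⇾𝟙⇾𝟙 x = begin
    (x ⇾ 𝟙) ⇾ 𝟙            ≡⟨ cong ((x ⇾ 𝟙) ⇾_) (x≤𝟙⇾x x) ⟨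
    (x ⇾ 𝟙) ⇾ x ⇾ 𝟙 ⇾ x    ≡⟨ ⇾-curry _ _ _ ⟨
    (x ⇾ 𝟙) ∙ x ⇾ 𝟙 ⇾ x    ≡⟨ cong (_⇾ 𝟙 ⇾ x) (𝟙⇾-as-∙ x) ⟨
    (𝟙 ⇾ x) ⇾ 𝟙 ⇾ x        ≡⟨ ⇾-refl _ ⟩
    𝟙                      ∎
    where open ≡-Reasoning

  𝟙⇾x≡x : ∀ x → 𝟙 ⇾ x ≡ x
  𝟙⇾x≡x x = ≤-antisym
    (begin
      (𝟙 ⇾ x) ⇾ x        ≡⟨ cong (_⇾ x) (𝟙⇾-as-∙ x) ⟩
      (x ⇾ 𝟙) ∙ x ⇾ x    ≡⟨ ⇾-curry _ _ _ ⟩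
      (x ⇾ 𝟙) ⇾ x ⇾ x    ≡⟨ cong ((x ⇾ 𝟙) ⇾_) (⇾-refl x) ⟩
      (x ⇾ 𝟙) ⇾ 𝟙        ≡⟨ ⇾𝟙⇾𝟙 x ⟩
      𝟙                  ∎)
    (x≤𝟙⇾x x)
    where open ≡-Reasoning

  x≤𝟙 : ∀ {x} → x ≤ 𝟙
  x≤𝟙 {x} = begin
    x ⇾ 𝟙              ≡⟨ cong (_⇾ 𝟙) x≡x⇾𝟙∙x ⟩
    (x ⇾ 𝟙) ∙ x ⇾ 𝟙    ≡⟨ ⇾-curry _ _ _ ⟩
    (x ⇾ 𝟙) ⇾ x ⇾ 𝟙    ≡⟨ ⇾-refl _ ⟩
    𝟙                  ∎
    where
    open ≡-Reasoning
    x≡x⇾𝟙∙x : x ≡ (x ⇾ 𝟙) ∙ x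
    x≡x⇾𝟙∙x = trans (sym (𝟙⇾x≡x x)) (𝟙⇾-as-∙ x)

  𝟙≤⇒≡𝟙 : ∀ {x} → 𝟙 ≤ x → x ≡ 𝟙
  𝟙≤⇒≡𝟙 = ≤-antisym x≤𝟙

  x≤y⇒[y⇾x]∙y≡x : ∀ {x y} → x ≤ y → (y ⇾ x) ∙ y ≡ x
  x≤y⇒[y⇾x]∙y≡x {x} {y} x≤y =
    trans (⇾-comm y x) (trans (cong (_∙ x) x≤y) (identityˡ x))

  x≤y⇒y∙[y⇝x]≡x : ∀ {x y} → x ≤ y → y ∙ (y ⇝ x) ≡ x
  x≤y⇒y∙[y⇝x]≡x {x} {y} x≤y =
    trans (sym (⇾-⇝ y x)) (trans (cong (_∙ x) x≤y) (identityˡ x))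

  -- Divisibility gives `x ≡ x ∙ (x ⇝ y)`, and currying then leaves an arrow from `x ⇝ y` to itself.
  -- With the converse, both arrows define the same order.
  ≤⇒⇝ : ∀ {x y} → x ≤ y → x ⇝ y ≡ 𝟙
  ≤⇒⇝ {x} {y} x≤y = begin
    x ⇝ y              ≡⟨ cong (_⇝ y) x∙[x⇝y]≡x ⟨
    x ∙ (x ⇝ y) ⇝ y    ≡⟨ ⇝-curry _ _ _ ⟩
    (x ⇝ y) ⇝ x ⇝ y    ≡⟨ ⇝-refl _ ⟩
    𝟙                  ∎
    where
    open ≡-Reasoning
    x∙[x⇝y]≡x : x ∙ (x ⇝ y) ≡ x
    x∙[x⇝y]≡x = trans (⇝-comm x y) (x≤y⇒y∙[y⇝x]≡x x≤y)

  ⇝⇒≤ : ∀ {x y} → x ⇝ y ≡ 𝟙 → x ≤ y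
  ⇝⇒≤ {x} {y} x⇝y≡𝟙 = begin
    x ⇾ y              ≡⟨ cong (_⇾ y) [x⇾y]∙x≡x ⟨
    (x ⇾ y) ∙ x ⇾ y    ≡⟨ ⇾-curry _ _ _ ⟩
    (x ⇾ y) ⇾ x ⇾ y    ≡⟨ ⇾-refl _ ⟩
    𝟙                  ∎
    where
    open ≡-Reasoning
    [x⇾y]∙x≡x : (x ⇾ y) ∙ x ≡ x
    [x⇾y]∙x≡x = trans (⇾-comm x y) (trans (⇾-⇝ x y)
      (trans (cong (x ∙_) x⇝y≡𝟙) (identityʳ x)))

  ≤-trans : ∀ {x y z} → x ≤ y → y ≤ z → x ≤ z
  ≤-trans {x} {y} {z} x≤y y≤z = begin
    x ⇾ z              ≡⟨ cong (_⇾ z) (x≤y⇒[y⇾x]∙y≡x x≤y) ⟨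
    (y ⇾ x) ∙ y ⇾ z    ≡⟨ ⇾-curry _ _ _ ⟩
    (y ⇾ x) ⇾ y ⇾ z    ≡⟨ cong ((y ⇾ x) ⇾_) y≤z ⟩
    (y ⇾ x) ⇾ 𝟙        ≡⟨ x≤𝟙 ⟩
    𝟙                  ∎
    where open ≡-Reasoning

  ≤-poset : Poset a a a
  ≤-poset = record
    { Carrier        = Carrier
    ; _≈_            = _≡_
    ; _≤_            = _≤_
    ; isPartialOrder = record
      { isPreorder = record
        { isEquivalence = isEquivalence
        ; reflexive     = λ { refl → ≤-refl }
        ; trans         = ≤-trans
        }
      ; antisym = ≤-antisym
      }
    }

  -- Residuation, monotonicity and conjugates.

  ∙-≤⇒≤-⇾ : ∀ {x y z} → x ∙ y ≤ z → x ≤ y ⇾ z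
  ∙-≤⇒≤-⇾ = trans (sym (⇾-curry _ _ _))

  ≤-⇾⇒∙-≤ : ∀ {x y z} → x ≤ y ⇾ z → x ∙ y ≤ z
  ≤-⇾⇒∙-≤ = trans (⇾-curry _ _ _)

  ∙-≤⇒≤-⇝ : ∀ {x y z} → x ∙ y ≤ z → y ≤ x ⇝ z
  ∙-≤⇒≤-⇝ p = ⇝⇒≤ (trans (sym (⇝-curry _ _ _)) (≤⇒⇝ p))

  ≤-⇝⇒∙-≤ : ∀ {x y z} → y ≤ x ⇝ z → x ∙ y ≤ z
  ≤-⇝⇒∙-≤ p = ⇝⇒≤ (trans (⇝-curry _ _ _) (≤⇒⇝ p))

  [x⇾y]∙x≤y : ∀ {x y} → (x ⇾ y) ∙ x ≤ y
  [x⇾y]∙x≤y = ≤-⇾⇒∙-≤ ≤-refl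

  x∙[x⇝y]≤y : ∀ {x y} → x ∙ (x ⇝ y) ≤ y
  x∙[x⇝y]≤y = ≤-⇝⇒∙-≤ ≤-refl

  ∙-monoˡ : ∀ {x y z} → x ≤ y → x ∙ z ≤ y ∙ z
  ∙-monoˡ x≤y = ≤-⇾⇒∙-≤ (≤-trans x≤y (∙-≤⇒≤-⇾ ≤-refl))

  ∙-monoʳ : ∀ {x y z} → x ≤ y → z ∙ x ≤ z ∙ y
  ∙-monoʳ x≤y = ≤-⇝⇒∙-≤ (≤-trans x≤y (∙-≤⇒≤-⇝ ≤-refl))

  ⇾-monoʳ : ∀ {x y z} → x ≤ y → z ⇾ x ≤ z ⇾ y
  ⇾-monoʳ x≤y = ∙-≤⇒≤-⇾ (≤-trans [x⇾y]∙x≤y x≤y)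

  ⇝-monoʳ : ∀ {x y z} → x ≤ y → z ⇝ x ≤ z ⇝ y
  ⇝-monoʳ x≤y = ∙-≤⇒≤-⇝ (≤-trans x∙[x⇝y]≤y x≤y)

  x∙y≤x : ∀ {x y} → x ∙ y ≤ x
  x∙y≤x {x} {y} = subst (x ∙ y ≤_) (identityʳ x) (∙-monoʳ x≤𝟙)

  x∙y≤y : ∀ {x y} → x ∙ y ≤ y
  x∙y≤y {x} {y} = subst (x ∙ y ≤_) (identityˡ y) (∙-monoˡ x≤𝟙)

  ∙-assoc : ∀ x y z → (x ∙ y) ∙ z ≡ x ∙ (y ∙ z)
  ∙-assoc x y z = ≤-antisym
    (≤-⇾⇒∙-≤ (≤-⇾⇒∙-≤ (subst (x ≤_) (⇾-curry y z _) (∙-≤⇒≤-⇾ ≤-refl))))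
    (≤-⇾⇒∙-≤ (subst (x ≤_) (sym (⇾-curry y z _)) (∙-≤⇒≤-⇾ (∙-≤⇒≤-⇾ ≤-refl))))

  -- By divisibility `y` has `x` as a left factor, which absorbs `z`.
  ∙-fixˡ-below : ∀ {x y z} → z ∙ x ≡ x → y ≤ x → z ∙ y ≡ y
  ∙-fixˡ-below {x} {y} {z} zx≡x y≤x = begin
    z ∙ y              ≡⟨ cong (z ∙_) (x≤y⇒y∙[y⇝x]≡x y≤x) ⟨
    z ∙ (x ∙ (x ⇝ y))  ≡⟨ ∙-assoc _ _ _ ⟨
    z ∙ x ∙ (x ⇝ y)    ≡⟨ cong (_∙ (x ⇝ y)) zx≡x ⟩
    x ∙ (x ⇝ y)        ≡⟨ x≤y⇒y∙[y⇝x]≡x y≤x ⟩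
    y                  ∎
    where open ≡-Reasoning

  ∙-fixʳ-below : ∀ {x y z} → x ∙ z ≡ x → y ≤ x → y ∙ z ≡ y
  ∙-fixʳ-below {x} {y} {z} xz≡x y≤x = begin
    y ∙ z              ≡⟨ cong (_∙ z) (x≤y⇒[y⇾x]∙y≡x y≤x) ⟨
    (x ⇾ y) ∙ x ∙ z    ≡⟨ ∙-assoc _ _ _ ⟩
    (x ⇾ y) ∙ (x ∙ z)  ≡⟨ cong ((x ⇾ y) ∙_) xz≡x ⟩
    (x ⇾ y) ∙ x        ≡⟨ x≤y⇒[y⇾x]∙y≡x y≤x ⟩
    y                  ∎
    where open ≡-Reasoning

  -- Since `x ∙ c` lies below `x`, it is fixed by `z` too, so `x ∙ c ≡ x ∙ c ∙ z ≤ c ∙ z`.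
  fixʳ⇒≤-conjugate : ∀ {x z} c → x ∙ z ≡ x → x ≤ c ⇾ c ∙ z
  fixʳ⇒≤-conjugate {x} {z} c xz≡x = ∙-≤⇒≤-⇾
    (subst (_≤ c ∙ z) (∙-fixʳ-below xz≡x x∙y≤x) (∙-monoˡ x∙y≤y))

  fixˡ⇒≤-conjugate : ∀ {x z} c → z ∙ x ≡ x → x ≤ c ⇝ z ∙ c
  fixˡ⇒≤-conjugate {x} {z} c zx≡x = ∙-≤⇒≤-⇝
    (subst (_≤ z ∙ c) (∙-fixˡ-below zx≡x x∙y≤y) (∙-monoʳ x∙y≤x))

  -- Orthogonal elements, those with supremum `𝟙`.

  IsSupremum-comm : ∀ {x y s} → IsSupremum x y s → IsSupremum y x s
  IsSupremum-comm (x≤s , y≤s , least) = y≤s , x≤s , λ t y≤t x≤t → least t x≤t y≤t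

  mkOrthogonal : ∀ {x y} → (∀ {t} → x ≤ t → y ≤ t → t ≡ 𝟙) → IsSupremum x y 𝟙
  mkOrthogonal f = x≤𝟙 , x≤𝟙 ,
    λ t x≤t y≤t → subst (𝟙 ≤_) (sym (f x≤t y≤t)) ≤-refl

  orthogonal-≡𝟙 : ∀ {x y t} → IsSupremum x y 𝟙 → x ≤ t → y ≤ t → t ≡ 𝟙
  orthogonal-≡𝟙 (_ , _ , least) x≤t y≤t = 𝟙≤⇒≡𝟙 (least _ x≤t y≤t)

  -- The residual `t ⇝ x` is an upper bound of both `x` and `y`, hence equals `𝟙`.
  orthogonal-cancelʳ : ∀ {x y t} → IsSupremum x y 𝟙 → t ∙ y ≤ x → t ≤ x
  orthogonal-cancelʳ x⊥y ty≤x =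
    ⇝⇒≤ (orthogonal-≡𝟙 x⊥y (∙-≤⇒≤-⇝ x∙y≤y) (∙-≤⇒≤-⇝ ty≤x))

  orthogonal-cancelˡ : ∀ {x y t} → IsSupremum x y 𝟙 → y ∙ t ≤ x → t ≤ x
  orthogonal-cancelˡ x⊥y yt≤x =
    orthogonal-≡𝟙 x⊥y (∙-≤⇒≤-⇾ x∙y≤x) (∙-≤⇒≤-⇾ yt≤x)

  -- Cancellation makes both `y ⇾ x` and `y ⇝ x` equal to `x`, so the two products are two
  -- expressions for the meet of `x` and `y`.
  orthogonal-comm : ∀ {x y} → IsSupremum x y 𝟙 → x ∙ y ≡ y ∙ x
  orthogonal-comm {x} {y} x⊥y = begin
    x ∙ y        ≡⟨ cong (_∙ y) (≤-antisym (∙-≤⇒≤-⇾ x∙y≤x)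
                      (orthogonal-cancelʳ x⊥y [x⇾y]∙x≤y)) ⟩
    (y ⇾ x) ∙ y  ≡⟨ ⇾-comm x y ⟨
    (x ⇾ y) ∙ x  ≡⟨ ⇾-⇝ y x ⟩
    y ∙ (y ⇝ x)  ≡⟨ cong (y ∙_) (≤-antisym
                      (orthogonal-cancelˡ x⊥y x∙[x⇝y]≤y) (∙-≤⇒≤-⇝ x∙y≤y)) ⟩
    y ∙ x        ∎
    where open ≡-Reasoning

  -- Normal filters and their congruences.

  record IsFilter (F : Pred Carrier a) : Set a where
    field
      𝟙-mem    : 𝟙 ∈ F
      ∙-closed : ∀ {x y} → x ∈ F → y ∈ F → x ∙ y ∈ F
      upward   : ∀ {x y} → x ≤ y → x ∈ F → y ∈ F

  -- Closure under conjugates is the form that can be checked directly here. It yields the usual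
  -- one, that `x ⇾ y ∈ F` iff `x ⇝ y ∈ F`.
  record IsNormalFilter (F : Pred Carrier a) : Set a where
    field
      isFilter : IsFilter F
      ⇾-normal : ∀ {z} c → z ∈ F → c ⇾ c ∙ z ∈ F
      ⇝-normal : ∀ {z} c → z ∈ F → c ⇝ z ∙ c ∈ F
    open IsFilter isFilter public

  module FilterCongruence {F : Pred Carrier a} (F-normal : IsNormalFilter F) where
    open IsNormalFilter F-normal

    infix 4 _≲_ _∼_
    _≲_ _∼_ : Carrier → Carrier → Set a
    x ≲ y = x ⇾ y ∈ F
    x ∼ y = x ≲ y × y ≲ x

    -- The conjugate of `x ⇾ y` by `x` is `x ⇝ (x ⇾ y) ∙ x`, which lies below `x ⇝ y`.
    ≲⇒⇝ : ∀ {x y} → x ≲ y → x ⇝ y ∈ F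
    ≲⇒⇝ {x} p = upward (⇝-monoʳ [x⇾y]∙x≤y) (⇝-normal x p)

    ⇝⇒≲ : ∀ {x y} → x ⇝ y ∈ F → x ≲ y
    ⇝⇒≲ {x} p = upward (⇾-monoʳ x∙[x⇝y]≤y) (⇾-normal x p)

    ≲-byˡ : ∀ {x y z} → z ∈ F → z ∙ x ≤ y → x ≲ y
    ≲-byˡ z∈F zx≤y = upward (∙-≤⇒≤-⇾ zx≤y) z∈F

    ≲-byʳ : ∀ {x y z} → z ∈ F → x ∙ z ≤ y → x ≲ y
    ≲-byʳ z∈F xz≤y = ⇝⇒≲ (upward (∙-≤⇒≤-⇝ xz≤y) z∈F)

    open ≤-Reasoning ≤-poset

    ≲-refl : ∀ {x} → x ≲ x
    ≲-refl = ≲-byˡ 𝟙-mem x∙y≤y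

    ≲-trans : ∀ {x y z} → x ≲ y → y ≲ z → x ≲ z
    ≲-trans {x} {y} {z} p q = ≲-byˡ (∙-closed q p) (begin
      (y ⇾ z) ∙ (x ⇾ y) ∙ x    ≡⟨ ∙-assoc _ _ _ ⟩
      (y ⇾ z) ∙ ((x ⇾ y) ∙ x)  ≤⟨ ∙-monoʳ [x⇾y]∙x≤y ⟩
      (y ⇾ z) ∙ y              ≤⟨ [x⇾y]∙x≤y ⟩
      z                        ∎)

    -- One factor changes at a time, via `x′ ∙ y`. The second change puts the filter element on the
    -- right, which is where normality enters.
    ∙-mono-≲ : ∀ {x x′ y y′} → x ≲ x′ → y ≲ y′ → x ∙ y ≲ x′ ∙ y′
    ∙-mono-≲ {x} {x′} {y} {y′} p q = ≲-trans
      (≲-byˡ p (begin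
        (x ⇾ x′) ∙ (x ∙ y)  ≡⟨ ∙-assoc _ _ _ ⟨
        (x ⇾ x′) ∙ x ∙ y    ≤⟨ ∙-monoˡ [x⇾y]∙x≤y ⟩
        x′ ∙ y              ∎))
      (≲-byʳ (≲⇒⇝ q) (begin
        x′ ∙ y ∙ (y ⇝ y′)    ≡⟨ ∙-assoc _ _ _ ⟩
        x′ ∙ (y ∙ (y ⇝ y′))  ≤⟨ ∙-monoʳ x∙[x⇝y]≤y ⟩
        x′ ∙ y′              ∎))

    ⇾-mono-≲ : ∀ {x x′ y y′} → x′ ≲ x → y ≲ y′ → x ⇾ y ≲ x′ ⇾ y′
    ⇾-mono-≲ {x} {x′} {y} {y′} p q = ≲-trans
      (≲-byʳ p (∙-≤⇒≤-⇾ (begin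
        (x ⇾ y) ∙ (x′ ⇾ x) ∙ x′    ≡⟨ ∙-assoc _ _ _ ⟩
        (x ⇾ y) ∙ ((x′ ⇾ x) ∙ x′)  ≤⟨ ∙-monoʳ [x⇾y]∙x≤y ⟩
        (x ⇾ y) ∙ x                ≤⟨ [x⇾y]∙x≤y ⟩
        y                          ∎)))
      (≲-byˡ q (∙-≤⇒≤-⇾ (begin
        (y ⇾ y′) ∙ (x′ ⇾ y) ∙ x′    ≡⟨ ∙-assoc _ _ _ ⟩
        (y ⇾ y′) ∙ ((x′ ⇾ y) ∙ x′)  ≤⟨ ∙-monoʳ [x⇾y]∙x≤y ⟩
        (y ⇾ y′) ∙ y                ≤⟨ [x⇾y]∙x≤y ⟩
        y′                          ∎)))

    ⇝-mono-≲ : ∀ {x x′ y y′} → x′ ≲ x → y ≲ y′ → x ⇝ y ≲ x′ ⇝ y′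
    ⇝-mono-≲ {x} {x′} {y} {y′} p q = ≲-trans
      (≲-byˡ (≲⇒⇝ p) (∙-≤⇒≤-⇝ (begin
        x′ ∙ ((x′ ⇝ x) ∙ (x ⇝ y))  ≡⟨ ∙-assoc _ _ _ ⟨
        x′ ∙ (x′ ⇝ x) ∙ (x ⇝ y)    ≤⟨ ∙-monoˡ x∙[x⇝y]≤y ⟩
        x ∙ (x ⇝ y)                ≤⟨ x∙[x⇝y]≤y ⟩
        y                          ∎)))
      (≲-byʳ (≲⇒⇝ q) (∙-≤⇒≤-⇝ (begin
        x′ ∙ ((x′ ⇝ y) ∙ (y ⇝ y′))  ≡⟨ ∙-assoc _ _ _ ⟨
        x′ ∙ (x′ ⇝ y) ∙ (y ⇝ y′)    ≤⟨ ∙-monoˡ x∙[x⇝y]≤y ⟩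
        y ∙ (y ⇝ y′)                ≤⟨ x∙[x⇝y]≤y ⟩
        y′                          ∎)))

    congruence : Congruence 𝐀
    congruence = record
      { _∼_           = _∼_
      ; isEquivalence = record
        { refl  = ≲-refl , ≲-refl
        ; sym   = swap
        ; trans = λ (p , p′) (q , q′) → ≲-trans p q , ≲-trans q′ p′
        }
      ; ∙-cong = λ (p , p′) (q , q′) → ∙-mono-≲ p q , ∙-mono-≲ p′ q′
      ; ⇾-cong = λ (p , p′) (q , q′) → ⇾-mono-≲ p′ q , ⇾-mono-≲ p q′
      ; ⇝-cong = λ (p , p′) (q , q′) → ⇝-mono-≲ p′ q , ⇝-mono-≲ p q′
      }

    mem⇒∼𝟙 : ∀ {z} → z ∈ F → z ∼ 𝟙
    mem⇒∼𝟙 z∈F = ≲-byˡ z∈F x≤𝟙 , ≲-byˡ z∈F x∙y≤x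

  -- If `x` and `y` are congruent modulo both filters, both residuals between them lie in the
  -- intersection and equal `𝟙`. A congruence that were equality would make its filter trivial, as
  -- members are congruent to `𝟙`.
  disjointNormalFilters⇒reducible : ∀ {F F′} → IsNormalFilter F → IsNormalFilter F′ →
    (∀ {z} → z ∈ F → z ∈ F′ → z ≡ 𝟙) →
    ¬ (∀ {z} → z ∈ F → z ≡ 𝟙) → ¬ (∀ {z} → z ∈ F′ → z ≡ 𝟙) →
    SubdirectlyReducible 𝐀
  disjointNormalFilters⇒reducible {F} {F′} F-normal F′-normal disjoint F-nontrivial F′-nontrivial =
    Lift a Bool , θ , θ-nontrivial ,
    (λ p → ≤-antisym (disjoint (proj₁ (p (lift true))) (proj₁ (p (lift false))))
                     (disjoint (proj₂ (p (lift true))) (proj₂ (p (lift false))))) ,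
    λ { refl i → reflexive i }
    where
    module C = FilterCongruence F-normal
    module C′ = FilterCongruence F′-normal

    θ : Lift a Bool → Congruence 𝐀
    θ (lift true)  = C.congruence
    θ (lift false) = C′.congruence

    θ-nontrivial : ∀ i → ¬ _
    θ-nontrivial (lift true)  (∼⇒≡ , _) = F-nontrivial λ z∈F → ∼⇒≡ (C.mem⇒∼𝟙 z∈F)
    θ-nontrivial (lift false) (∼⇒≡ , _) = F′-nontrivial λ z∈F′ → ∼⇒≡ (C′.mem⇒∼𝟙 z∈F′)

    reflexive : ∀ {x} i → Congruence._∼_ (θ i) x x
    reflexive (lift true)  = C.≲-refl , C.≲-refl
    reflexive (lift false) = C′.≲-refl , C′.≲-refl

  -- Polars and products of orthogonal filters.

  ^⊥-isFilter : ∀ M → IsFilter (M ^⊥)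
  ^⊥-isFilter M = record
    { 𝟙-mem    = λ _ → mkOrthogonal λ 𝟙≤t _ → 𝟙≤⇒≡𝟙 𝟙≤t
    -- First `y ⇾ t` bounds `x` and `m`, so `y ≤ t`; then `t` bounds `y` and `m`.
    ; ∙-closed = λ x⊥ y⊥ m∈M → mkOrthogonal λ xy≤t m≤t →
        orthogonal-≡𝟙 (y⊥ m∈M)
          (orthogonal-≡𝟙 (x⊥ m∈M) (∙-≤⇒≤-⇾ xy≤t) (∙-≤⇒≤-⇾ (≤-trans x∙y≤x m≤t)))
          m≤t
    ; upward   = λ x≤y x⊥ m∈M → mkOrthogonal λ y≤t m≤t →
        orthogonal-≡𝟙 (x⊥ m∈M) (≤-trans x≤y y≤t) m≤t
    }

  ⊙-isFilter : ∀ {P Q} → IsFilter P → IsFilter Q →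
    (∀ {p q} → p ∈ P → q ∈ Q → IsSupremum p q 𝟙) → IsFilter (P ⊙ Q)
  ⊙-isFilter {P} {Q} P-filter Q-filter P⊥Q = record
    { 𝟙-mem    = 𝟙 , 𝟙 , P.𝟙-mem , Q.𝟙-mem , sym (identityʳ 𝟙)
    ; ∙-closed = λ { (p , q , p∈P , q∈Q , refl) (p′ , q′ , p′∈P , q′∈Q , refl) →
        p ∙ p′ , q ∙ q′ , P.∙-closed p∈P p′∈P , Q.∙-closed q∈Q q′∈Q , (begin
          p ∙ q ∙ (p′ ∙ q′)    ≡⟨ ∙-assoc _ _ _ ⟩
          p ∙ (q ∙ (p′ ∙ q′))  ≡⟨ cong (p ∙_) (∙-assoc _ _ _) ⟨
          p ∙ (q ∙ p′ ∙ q′)    ≡⟨ cong (λ r → p ∙ (r ∙ q′)) (orthogonal-comm (P⊥Q p′∈P q∈Q)) ⟨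
          p ∙ (p′ ∙ q ∙ q′)    ≡⟨ cong (p ∙_) (∙-assoc _ _ _) ⟩
          p ∙ (p′ ∙ (q ∙ q′))  ≡⟨ ∙-assoc _ _ _ ⟨
          p ∙ p′ ∙ (q ∙ q′)    ∎) }
    ; upward   = λ { {y = y} pq≤y (p , q , p∈P , q∈Q , refl) →
        -- As `y ≤ q ⇾ y`, divisibility splits `y` into these two factors, the first above `p` and
        -- the second above `q`.
        q ⇾ y , (q ⇾ y) ⇝ y ,
        P.upward (∙-≤⇒≤-⇾ pq≤y) p∈P , Q.upward (∙-≤⇒≤-⇝ [x⇾y]∙x≤y) q∈Q ,
        sym (x≤y⇒y∙[y⇝x]≡x (∙-≤⇒≤-⇾ x∙y≤x)) }
    }
    where
    module P = IsFilter P-filter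
    module Q = IsFilter Q-filter
    open ≡-Reasoning

  -- Consequences of a least element of a filter above `x`.

  module LeastAbove {G : Pred Carrier a} (G-filter : IsFilter G) {x g : Carrier}
                    (g-least : IsLeast (λ y → y ∈ G × x ≤ y) g) where
    open IsFilter G-filter

    h : Carrier
    h = g ⇾ x

    g∈G : g ∈ G
    g∈G = proj₁ (proj₁ g-least)

    x≤g : x ≤ g
    x≤g = proj₂ (proj₁ g-least)

    g≤_ : ∀ {y} → y ∈ G → x ≤ y → g ≤ y
    (g≤ y∈G) x≤y = proj₂ g-least (y∈G , x≤y)

    h∙g≡x : h ∙ g ≡ x
    h∙g≡x = x≤y⇒[y⇾x]∙y≡x x≤g

    -- The product `z ∙ g` is in `G` and above `h ∙ g`, which is `x`, so leastness applies.
    z∙g≡g : ∀ {z} → z ∈ G → h ≤ z → z ∙ g ≡ g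
    z∙g≡g {z} z∈G h≤z = ≤-antisym x∙y≤y
      ((g≤ ∙-closed z∈G g∈G) (subst (_≤ z ∙ g) h∙g≡x (∙-monoˡ h≤z)))

    -- The element p ⇝ x, with p = z ⇾ h, lies above x and above z ∙ g, so it
    -- belongs to G and hence lies above g.
    z⇾h≤h : ∀ {z} → z ∈ G → z ⇾ h ≤ h
    z⇾h≤h {z} z∈G = ∙-≤⇒≤-⇾ (≤-⇝⇒∙-≤
      ((g≤ upward (∙-≤⇒≤-⇝ p∙zg≤x) (∙-closed z∈G g∈G)) (∙-≤⇒≤-⇝ x∙y≤y)))
      where
      p∙zg≤x : (z ⇾ h) ∙ (z ∙ g) ≤ x
      p∙zg≤x = subst (_≤ x) (∙-assoc _ _ _) (≤-⇾⇒∙-≤ [x⇾y]∙x≤y)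

    -- In fact `z ⇾ h` equals `h`; for `z` above `h`, divisibility then turns the right side into
    -- `h`.
    h∙z≡[z⇾h]∙z : ∀ {z} → z ∈ G → h ∙ z ≡ (z ⇾ h) ∙ z
    h∙z≡[z⇾h]∙z {z} z∈G = cong (_∙ z) (≤-antisym (∙-≤⇒≤-⇾ x∙y≤x) (z⇾h≤h z∈G))

    h∙z≡h : ∀ {z} → z ∈ G → h ≤ z → h ∙ z ≡ h
    h∙z≡h z∈G h≤z = trans (h∙z≡[z⇾h]∙z z∈G) (x≤y⇒[y⇾x]∙y≡x h≤z)

    -- As `x` lies below `h`, it is fixed by `z` on the right. Thus `x ≡ x ∙ z ≤ g ∙ z`, and
    -- leastness applies.
    g∙z≡g : ∀ {z} → z ∈ G → h ≤ z → g ∙ z ≡ g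
    g∙z≡g {z} z∈G h≤z = ≤-antisym x∙y≤x
      ((g≤ ∙-closed g∈G z∈G) (subst (_≤ g ∙ z) x∙z≡x (∙-monoˡ x≤g)))
      where
      x≤h : x ≤ h
      x≤h = subst (_≤ h) h∙g≡x x∙y≤x
      x∙z≡x : x ∙ z ≡ x
      x∙z≡x = ∙-fixʳ-below (h∙z≡h z∈G h≤z) x≤h

    -- With `h ≡ z ∙ (z ⇝ h)`, it suffices that `z ⇝ h ≤ h`, that is, `(z ⇝ h) ∙ g ≤ x`. Left
    -- multiplication by `z` fixes this product, being below `g`, and also turns it into `h ∙ g`.
    z∙h≡h : ∀ {z} → z ∈ G → h ≤ z → z ∙ h ≡ h
    z∙h≡h {z} z∈G h≤z = ≤-antisym x∙y≤y
      (subst (_≤ z ∙ h) (x≤y⇒y∙[y⇝x]≡x h≤z) (∙-monoʳ (∙-≤⇒≤-⇾ (begin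
        (z ⇝ h) ∙ g        ≡⟨ ∙-fixˡ-below (z∙g≡g z∈G h≤z) x∙y≤y ⟨
        z ∙ ((z ⇝ h) ∙ g)  ≡⟨ ∙-assoc _ _ _ ⟨
        z ∙ (z ⇝ h) ∙ g    ≡⟨ cong (_∙ g) (x≤y⇒y∙[y⇝x]≡x h≤z) ⟩
        h ∙ g              ≡⟨ h∙g≡x ⟩
        x                  ∎))))
      where open ≤-Reasoning ≤-poset

    -- Treats one factor of `G` at a time; the other is covered by exchanging the two components of
    -- `g`, which commute.
    module _ {P : Pred Carrier a} (P-filter : IsFilter P) (P⊆G : P ⊆ G)
             {p q : Carrier} (p∈P : p ∈ P)
             (P⊥q : ∀ {y} → y ∈ P → IsSupremum y q 𝟙) (g≡p∙q : g ≡ p ∙ q) where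
      private module P = IsFilter P-filter

      -- From `p ∙ q ≡ z ∙ g ≤ z ∙ p` the factor `q` cancels, being orthogonal to `z ∙ p ∈ P`.
      z∙p≡p : ∀ {z} → z ∈ P → h ≤ z → z ∙ p ≡ p
      z∙p≡p {z} z∈P h≤z = ≤-antisym x∙y≤y
        (orthogonal-cancelʳ (P⊥q (P.∙-closed z∈P p∈P)) (begin
          p ∙ q        ≡⟨ g≡p∙q ⟨
          g            ≡⟨ z∙g≡g (P⊆G z∈P) h≤z ⟨
          z ∙ g        ≡⟨ cong (z ∙_) g≡p∙q ⟩
          z ∙ (p ∙ q)  ≤⟨ ∙-monoʳ x∙y≤x ⟩
          z ∙ p        ∎))
        where open ≤-Reasoning ≤-poset

      p∙z≡p : ∀ {z} → z ∈ P → h ≤ z → p ∙ z ≡ p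
      p∙z≡p {z} z∈P h≤z = ≤-antisym x∙y≤x
        (orthogonal-cancelˡ (P⊥q (P.∙-closed p∈P z∈P)) (begin
          q ∙ p        ≡⟨ g≡q∙p ⟨
          g            ≡⟨ g∙z≡g (P⊆G z∈P) h≤z ⟨
          g ∙ z        ≡⟨ cong (_∙ z) g≡q∙p ⟩
          q ∙ p ∙ z    ≤⟨ ∙-monoˡ x∙y≤y ⟩
          p ∙ z        ∎))
        where
        open ≤-Reasoning ≤-poset
        g≡q∙p : g ≡ q ∙ p
        g≡q∙p = trans g≡p∙q (orthogonal-comm (P⊥q p∈P))

      above-h-isNormalFilter : IsNormalFilter (λ z → z ∈ P × h ≤ z)
      above-h-isNormalFilter = record
        { isFilter = record
          { 𝟙-mem    = P.𝟙-mem , x≤𝟙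
          -- The product stays above `h` because `h ≡ z ∙ h ≤ z ∙ z′`.
          ; ∙-closed = λ { {z} {z′} (z∈P , h≤z) (z′∈P , h≤z′) → P.∙-closed z∈P z′∈P ,
              subst (_≤ z ∙ z′) (z∙h≡h (P⊆G z∈P) h≤z) (∙-monoʳ h≤z′) }
          ; upward   = λ z≤y (z∈P , h≤z) → P.upward z≤y z∈P , ≤-trans h≤z z≤y
          }
        ; ⇾-normal = λ c (z∈P , h≤z) →
            P.upward (fixʳ⇒≤-conjugate c (p∙z≡p z∈P h≤z)) p∈P ,
            fixʳ⇒≤-conjugate c (h∙z≡h (P⊆G z∈P) h≤z)
        ; ⇝-normal = λ c (z∈P , h≤z) →
            P.upward (fixˡ⇒≤-conjugate c (z∙p≡p z∈P h≤z)) p∈P ,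
            fixˡ⇒≤-conjugate c (z∙h≡h (P⊆G z∈P) h≤z)
        }

    -- Any upper bound of `h` and a member of `P` is itself in `P` and above `h`.
    trivial-above-h : ∀ {P} → IsFilter P →
      (∀ {z} → z ∈ P × h ≤ z → z ≡ 𝟙) → h ∈ P ^⊥
    trivial-above-h P-filter trivial y∈P = mkOrthogonal λ h≤t y≤t →
      trivial (IsFilter.upward P-filter y≤t y∈P , h≤t)

theorem4p6 : ∀ {a} (𝐀 : PseudoHoop a) → let open PseudoHoop 𝐀 in
    (M : Pred Carrier a) → let G = (M ^⊥) ⊙ (M ^⊥ ^⊥) in
    (∃[ x ] (x ∉ G × ∃[ g ] IsLeast (λ y → y ∈ G × x ≤ y) g)) →
    SubdirectlyReducible 𝐀
theorem4p6 {a} 𝐀 M (x , x∉G , g , g-least@(((p , q , p∈P , q∈Q , g≡p∙q) , _) , _)) =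
  disjointNormalFilters⇒reducible
    (above-h-isNormalFilter P-filter P⊆G p∈P (λ y∈P → P⊥Q y∈P q∈Q) g≡p∙q)
    (above-h-isNormalFilter Q-filter Q⊆G q∈Q (λ y∈Q → y∈Q p∈P)
      (trans g≡p∙q (orthogonal-comm (P⊥Q p∈P q∈Q))))
    (λ (z∈P , _) (z∈Q , _) → orthogonal-≡𝟙 (P⊥Q z∈P z∈Q) ≤-refl ≤-refl)
    (λ trivial → h∉G (Q⊆G (trivial-above-h P-filter trivial)))
    -- Here `h` is orthogonal to all of `Q`, and `Q` contains `M`, so `h` lies in `P`.
    (λ trivial → h∉G (P⊆G (λ m∈M →
      trivial-above-h Q-filter trivial (λ y∈P → IsSupremum-comm (y∈P m∈M)))))
  where
  open PseudoHoop 𝐀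
  open PseudoHoopProperties 𝐀

  P Q G : Pred Carrier a
  P = M ^⊥
  Q = P ^⊥
  G = P ⊙ Q

  P-filter : IsFilter P
  P-filter = ^⊥-isFilter M

  Q-filter : IsFilter Q
  Q-filter = ^⊥-isFilter P

  P⊥Q : ∀ {y z} → y ∈ P → z ∈ Q → IsSupremum y z 𝟙
  P⊥Q y∈P z∈Q = IsSupremum-comm (z∈Q y∈P)

  G-filter : IsFilter G
  G-filter = ⊙-isFilter P-filter Q-filter P⊥Q

  P⊆G : P ⊆ G
  P⊆G y∈P = _ , 𝟙 , y∈P , IsFilter.𝟙-mem Q-filter , sym (identityʳ _)

  Q⊆G : Q ⊆ G
  Q⊆G y∈Q = 𝟙 , _ , IsFilter.𝟙-mem P-filter , y∈Q , sym (identityˡ _)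

  open LeastAbove G-filter g-least

  h∉G : h ∉ G
  h∉G h∈G = x∉G (subst G h∙g≡x (IsFilter.∙-closed G-filter h∈G g∈G))
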